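{- Let $n\in\mathbb{N}$, $n>2$. Then for every computable abelian group $G$ and every $b\in G$, $b\neq 0$, there is a computable $n$-coloring $c$ of $G$ with no monochromatic solutions to $x-y=b$.
   Context: A computable group is a group whose underlying set and group operations are computable. An $n$-coloring of $G$ is any map $c:G\to n=\{0,\dots,n-1\}$. A monochromatic solution (for $c$) of $x-y=b$ is a pair $(x,y)\in G^2$ with $x-y=b$ and $c(x)=c(y)$. -}

module Defs where

open import Algebra.Bundles using (Group)
open import Algebra.Definitions using (Commutative)
open import Algebra.Structures using (IsGroup)
open import Data.Bool using (if_then_else_)
open import Data.Fin using (Fin; toℕ)
open import Data.Nat using (ℕ; zero; suc; _<_)
open import Data.Product using (Σ; ∃-syntax; _×_; proj₁)
open import Data.Vec using (Vec; []; _∷_; lookup)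
open import Data.Vec.Relation.Binary.Pointwise.Inductive using (Pointwise)
open import Function.Bundles using (Func)
open import Level using (0ℓ)
open import Relation.Binary.Core using (Rel)
open import Relation.Binary.PropositionalEquality using (_≡_; setoid)
open import Relation.Nullary using (does)
open import Relation.Unary using (Pred; Decidable)

-- Programs for the k-ary partial recursive functions.

data Rec : ℕ → Set where
  zeroᶠ : ∀ {k} → Rec k
  sucᶠ  : Rec 1
  proj  : ∀ {k} → Fin k → Rec k
  comp  : ∀ {k m} → Rec m → Vec (Rec k) m → Rec k
  prec  : ∀ {k} → Rec k → Rec (suc (suc k)) → Rec (suc k)
  μ     : ∀ {k} → Rec (suc k) → Rec k

-- p [ xs ]⇓ y : program p halts on input xs with output y.

infix 4 _[_]⇓_

data _[_]⇓_ : ∀ {k} → Rec k → Vec ℕ k → ℕ → Set where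
  zero-⇓ : ∀ {k} {xs : Vec ℕ k} → zeroᶠ [ xs ]⇓ 0
  suc-⇓  : ∀ {x} → sucᶠ [ x ∷ [] ]⇓ suc x
  proj-⇓ : ∀ {k} {i : Fin k} {xs} → proj i [ xs ]⇓ lookup xs i
  comp-⇓ : ∀ {k m} {f : Rec m} {gs : Vec (Rec k) m} {xs ys z} →
           Pointwise (λ g y → g [ xs ]⇓ y) gs ys →
           f [ ys ]⇓ z →
           comp f gs [ xs ]⇓ z
  prec-zero-⇓ : ∀ {k} {f : Rec k} {g xs y} →
           f [ xs ]⇓ y →
           prec f g [ zero ∷ xs ]⇓ y
  prec-suc-⇓ : ∀ {k} {f : Rec k} {g n xs y z} →
           prec f g [ n ∷ xs ]⇓ y →
           g [ n ∷ y ∷ xs ]⇓ z →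
           prec f g [ suc n ∷ xs ]⇓ z
  μ-⇓    : ∀ {k} {f : Rec (suc k)} {xs y} →
           (∀ i → i < y → ∃[ z ] f [ i ∷ xs ]⇓ suc z) →
           f [ y ∷ xs ]⇓ 0 →
           μ f [ xs ]⇓ y

ComputableSet : Pred ℕ 0ℓ → Set
ComputableSet U =
  Σ (Decidable U) λ U? →
  ∃[ p ] ∀ x → p [ x ∷ [] ]⇓ (if does (U? x) then 1 else 0)

-- A function defined on a subset U of ℕ is computable when some program
-- computes it on U; nothing is asked of the program on inputs outside U.

Computable₁ : (U : Pred ℕ 0ℓ) → (Σ ℕ U → ℕ) → Set
Computable₁ U f = ∃[ p ] ∀ x → p [ proj₁ x ∷ [] ]⇓ f x

Computable₂ : (U : Pred ℕ 0ℓ) → (Σ ℕ U → Σ ℕ U → ℕ) → Set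
Computable₂ U f = ∃[ p ] ∀ x y → p [ proj₁ x ∷ proj₁ y ∷ [] ]⇓ f x y

record ComputableGroup : Set₁ where
  infixl 6 _+_
  infix  8 -_
  infix  4 _≈_

  field
    U : Pred ℕ 0ℓ

  Carrier : Set
  Carrier = Σ ℕ U

  -- Elements are equal when they are the same number, whatever the
  -- membership proofs.
  _≈_ : Rel Carrier 0ℓ
  x ≈ y = proj₁ x ≡ proj₁ y

  field
    _+_     : Carrier → Carrier → Carrier
    0#      : Carrier
    -_      : Carrier → Carrier
    isGroup : IsGroup _≈_ _+_ 0# -_

    U-computable   : ComputableSet U
    add-computable : Computable₂ U (λ x y → proj₁ (x + y))
    neg-computable : Computable₁ U (λ x → proj₁ (- x))

  group : Group 0ℓ 0ℓ
  group = record { isGroup = isGroup }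

  open Group group public using () renaming (setoid to ≈-setoid; _//_ to infixl 6 _-_)

IsAbelian : ComputableGroup → Set
IsAbelian G = Commutative _≈_ _+_
  where open ComputableGroup G

module _ (G : ComputableGroup) where
  open ComputableGroup G

  Coloring : ℕ → Set
  Coloring n = Func ≈-setoid (setoid (Fin n))

  ComputableColoring : ∀ {n} → Coloring n → Set
  ComputableColoring c = Computable₁ U (λ x → toℕ (Func.to c x))

  MonochromaticSolution : ∀ {n} → Coloring n → Carrier → Set
  MonochromaticSolution c b =
    ∃[ x ] ∃[ y ] (x - y ≈ b × Func.to c x ≡ Func.to c y)

{-# OPTIONS --safe #-}
-- On codes in ℕ, every x has the two neighbours b + x and - b + x.  A peak
-- (a number larger than both its neighbours) gets colour 2.  Any other number
-- has at most one smaller neighbour; moving to it repeatedly stops after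
-- finitely many steps, and the parity of their number is the colour.  Two
-- peaks are never adjacent, and of two adjacent non-peaks the larger moves to
-- the smaller, so their parities differ.
module Submission where

import Algebra.Properties.Group as GroupProperties
open import Algebra.Structures using (IsGroup)
open import Data.Bool using (if_then_else_)
open import Data.Fin using (Fin; fromℕ<; toℕ)
open import Data.Fin.Patterns using (0F; 1F; 3F)
open import Data.Fin.Properties using (toℕ-fromℕ<; fromℕ<-cong)
open import Data.Nat using (ℕ; zero; suc; pred; _>_; _<_; _≤_; _∸_; z≤n; s≤s; _<?_)
open import Data.Nat.GeneralisedArithmetic using (fold)
open import Data.Nat.Induction using (Acc; acc; <-wellFounded)
open import Data.Nat.Properties
  using (<-cmp; ≤-refl; ≤-reflexive; ≤-trans; <-≤-trans; ≤-<-trans; <-irrefl; <⇒≤; ≮⇒≥;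
         m≤n⇒m∸n≡0; m<n⇒0<n∸m; m∸n≢0⇒n<m; m∸n≤m; 0∸n≡0; 0≢1+n; m<n⇒m<1+n; pred[m∸n]≡m∸[1+n])
open import Data.Product using (Σ; ∃-syntax; _×_; _,_; proj₁; proj₂)
open import Data.Sum using (_⊎_; inj₁; inj₂)
open import Data.Vec using (Vec; []; _∷_; lookup)
open import Data.Vec.Relation.Binary.Pointwise.Inductive using ([]; _∷_)
open import Function.Bundles using (Func)
open import Relation.Binary.Definitions using (tri<; tri≈; tri>)
open import Relation.Binary.PropositionalEquality
  using (_≡_; _≢_; refl; sym; trans; cong; subst; module ≡-Reasoning)
import Relation.Binary.Reasoning.Setoid as ≈-Reasoning
open import Relation.Nullary using (¬_; Dec; yes; no; does; contradiction)
open import Defs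

-- Order tests by truncated subtraction, and parity.

>⇒∸≡suc : ∀ {m n} → n < m → ∃[ z ] m ∸ n ≡ suc z
>⇒∸≡suc {m} {n} n<m with m ∸ n | m<n⇒0<n∸m n<m
... | suc z | _ = z , refl

-- Branching on a number rather than on a decision keeps this primitive recursive. Applied to
-- `m ∸ n`, it tests whether `n < m`.
caseℕ : ℕ → ℕ → ℕ → ℕ
caseℕ zero    a b = a
caseℕ (suc _) a b = b

caseℕ-idem : ∀ n {a} → caseℕ n a a ≡ a
caseℕ-idem zero    = refl
caseℕ-idem (suc _) = refl

caseℕ-≤ : ∀ {m n a b} → m ≤ n → caseℕ (m ∸ n) a b ≡ a
caseℕ-≤ m≤n rewrite m≤n⇒m∸n≡0 m≤n = refl

caseℕ-> : ∀ {m n a b} → n < m → caseℕ (m ∸ n) a b ≡ b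
caseℕ-> n<m rewrite proj₂ (>⇒∸≡suc n<m) = refl

caseℕ-< : ∀ n {a b c} → a < c → b < c → caseℕ n a b < c
caseℕ-< zero    a<c b<c = a<c
caseℕ-< (suc _) a<c b<c = b<c

parity : ℕ → ℕ
parity zero    = 0
parity (suc n) = 1 ∸ parity n

parity<2 : ∀ n → parity n < 2
parity<2 zero    = s≤s z≤n
parity<2 (suc n) = s≤s (m∸n≤m 1 (parity n))

1∸n≢n : ∀ n → 1 ∸ n ≢ n
-- `1 ∸ suc n` reduces only to `0 ∸ n`, which is stuck until rewritten to 0.
1∸n≢n (suc n) eq with () ← trans (sym (0∸n≡0 n)) eq

-- Length of the descent along iterates of a function.

module Height (f : ℕ → ℕ) where

  drop : ℕ → ℕ
  drop x = x ∸ f x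

  -- Shaped like the two premises of `μ-⇓`, so that unbounded search for a zero of `drop` along the
  -- iterates returns the height.
  IsHeight : ℕ → ℕ → Set
  IsHeight x k =
    (∀ i → i < k → ∃[ z ] drop (fold x f i) ≡ suc z) × drop (fold x f k) ≡ 0

  isHeight-suc : ∀ {x k z} → drop x ≡ suc z → IsHeight (f x) k → IsHeight x (suc k)
  isHeight-suc {x} {k} {z} eq (above , stop) =
    above′ , subst (λ w → drop w ≡ 0) (shift k) stop
    where
    shift : ∀ i → fold (f x) f i ≡ fold x f (suc i)
    shift zero    = refl
    shift (suc i) = cong f (shift i)

    above′ : ∀ i → i < suc k → ∃[ w ] drop (fold x f i) ≡ suc w
    above′ zero    _         = z , eq
    above′ (suc i) (s≤s i<k) =
      subst (λ v → ∃[ w ] drop v ≡ suc w) (shift i) (above i i<k)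

  -- If one candidate were smaller, `drop` would be zero there by the first property and positive by
  -- the second. This yields the recursion equation of `height` without unfolding its accessibility
  -- proof.
  isHeight-unique : ∀ {x k l} → IsHeight x k → IsHeight x l → k ≡ l
  isHeight-unique {x} {k} {l} (above , stop) (above′ , stop′) with <-cmp k l
  ... | tri≈ _ k≡l _ = k≡l
  ... | tri< k<l _ _ with () ← trans (sym stop) (proj₂ (above′ k k<l))
  ... | tri> _ _ l<k with () ← trans (sym stop′) (proj₂ (above l l<k))

  hasHeight : ∀ x → Acc _<_ x → ∃[ k ] IsHeight x k
  hasHeight x (acc rs) with drop x in eq
  ... | zero  = 0 , (λ _ ()) , eq
  ... | suc z =
    -- A nonzero `drop x` means `f x < x`, which is what the accessibility argument needs.
    let k , isHeight = hasHeight (f x) (rs (m∸n≢0⇒n<m λ eq′ → 0≢1+n (trans (sym eq′) eq)))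
    in suc k , isHeight-suc eq isHeight

  height : ℕ → ℕ
  height x = proj₁ (hasHeight x (<-wellFounded x))

  height-correct : ∀ x → IsHeight x (height x)
  height-correct x = proj₂ (hasHeight x (<-wellFounded x))

  height-step : ∀ {x} → f x < x → height x ≡ suc (height (f x))
  height-step {x} fx<x =
    isHeight-unique (height-correct x)
      (isHeight-suc (proj₂ (>⇒∸≡suc fx<x)) (height-correct (f x)))

-- The colouring for two abstract neighbour functions.

module PeakColoring (up down : ℕ → ℕ) where

  -- The default `x`, taken when neither neighbour is smaller, makes `drop x` zero and so ends the
  -- descent.
  descend : ℕ → ℕ
  descend x = caseℕ (x ∸ up x) (caseℕ (x ∸ down x) x (down x)) (up x)

  open Height descend public

  color : ℕ → ℕ
  color x =
    caseℕ (x ∸ up x) (parity (height x)) (caseℕ (x ∸ down x) (parity (height x)) 2)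

  color<3 : ∀ x → color x < 3
  color<3 x = caseℕ-< (x ∸ up x) p<3 (caseℕ-< (x ∸ down x) p<3 ≤-refl)
    where p<3 = m<n⇒m<1+n (parity<2 (height x))

  color-peak : ∀ {x} → up x < x → down x < x → color x ≡ 2
  color-peak u<x d<x = trans (caseℕ-> u<x) (caseℕ-> d<x)

  color-nonpeak : ∀ {x} → x ≤ up x ⊎ x ≤ down x → color x ≡ parity (height x)
  color-nonpeak (inj₁ x≤u) = caseℕ-≤ x≤u
  -- The inner case collapses to the parity, so both outer branches agree and `x` need not be
  -- compared with `up x`.
  color-nonpeak {x} (inj₂ x≤d) =
    trans (cong (caseℕ (x ∸ up x) _) (caseℕ-≤ x≤d)) (caseℕ-idem (x ∸ up x))

  color-peak-≢ : ∀ {x y} → up x < x → down x < x → y ≤ up y ⊎ y ≤ down y →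
                 color x ≢ color y
  color-peak-≢ {x} {y} u<x d<x nonpeak eq = <-irrefl 2≡parity (parity<2 (height y))
    where
    2≡parity : parity (height y) ≡ 2
    2≡parity = trans (sym (color-nonpeak nonpeak)) (trans (sym eq) (color-peak u<x d<x))

  color-descend-≢ : ∀ {x y} → x ≤ up x ⊎ x ≤ down x → y ≤ up y ⊎ y ≤ down y →
                    descend x ≡ y → y < x → color x ≢ color y
  color-descend-≢ {x} {y} nonpeak-x nonpeak-y refl y<x eq = 1∸n≢n (parity (height y)) (begin
    parity (suc (height y)) ≡⟨ cong parity (height-step y<x) ⟨
    parity (height x)       ≡⟨ color-nonpeak nonpeak-x ⟨
    color x                 ≡⟨ eq ⟩
    color y                 ≡⟨ color-nonpeak nonpeak-y ⟩
    parity (height y)       ∎)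
    where open ≡-Reasoning

  -- The smaller endpoint is a non-peak because the other one is its neighbour; the larger is a peak
  -- or descends to the smaller. The hypotheses concern a single edge, since translations of codes
  -- need not be mutually inverse outside the group.
  color-≢ : ∀ {x y} → up y ≡ x → down x ≡ y → x ≢ y → color x ≢ color y
  color-≢ {x} {y} refl down≡ x≢y with <-cmp x y
  ... | tri≈ _ x≡y _ = contradiction x≡y x≢y
  ... | tri< x<y _ _ = λ eq → larger (sym eq)
    where
    nonpeak : x ≤ up x ⊎ x ≤ down x
    nonpeak = inj₂ (≤-trans (<⇒≤ x<y) (≤-reflexive (sym down≡)))

    larger : color y ≢ color x
    larger with down y <? y
    ... | yes d<y = color-peak-≢ x<y d<y nonpeak
    ... | no  d≮y = color-descend-≢ (inj₂ (≮⇒≥ d≮y)) nonpeak (caseℕ-> x<y) x<y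
  ... | tri> _ _ y<x = larger
    where
    d<x : down x < x
    d<x = ≤-<-trans (≤-reflexive down≡) y<x

    nonpeak : y ≤ up y ⊎ y ≤ down y
    nonpeak = inj₁ (<⇒≤ y<x)

    larger : color x ≢ color y
    larger with up x <? x
    ... | yes u<x = color-peak-≢ u<x d<x nonpeak
    -- `descend` tries `up` first, so reaching `down x` requires `x ≤ up x`.
    ... | no  u≮x = color-descend-≢ (inj₁ (≮⇒≥ u≮x)) nonpeak
                      (trans (caseℕ-≤ (≮⇒≥ u≮x)) (trans (caseℕ-> d<x) down≡)) y<x

-- Programs for the colouring.

⇓-resp : ∀ {k} {p : Rec k} {xs y z} → y ≡ z → p [ xs ]⇓ y → p [ xs ]⇓ z
⇓-resp refl p⇓ = p⇓

-- The vector holds the values of the variables of an open term. Such terms are built by applying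
-- the curried `Recursive` functions to one another.
Computable : ∀ {k} → (Vec ℕ k → ℕ) → Set
Computable {k} F = Σ (Rec k) λ p → ∀ xs → p [ xs ]⇓ F xs

Recursive₁ : (ℕ → ℕ) → Set
Recursive₁ f = Σ (Rec 1) λ p → ∀ x → p [ x ∷ [] ]⇓ f x

Recursive₂ : (ℕ → ℕ → ℕ) → Set
Recursive₂ f = Σ (Rec 2) λ p → ∀ x y → p [ x ∷ y ∷ [] ]⇓ f x y

Recursive₃ : (ℕ → ℕ → ℕ → ℕ) → Set
Recursive₃ f = Σ (Rec 3) λ p → ∀ x y z → p [ x ∷ y ∷ z ∷ [] ]⇓ f x y z

recursive₁ : ∀ {F : Vec ℕ 1 → ℕ} → Computable F → Recursive₁ (λ x → F (x ∷ []))
recursive₁ (p , p⇓) = p , λ x → p⇓ (x ∷ [])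

module _ {k : ℕ} where

  var : (i : Fin k) → Computable (λ xs → lookup xs i)
  var i = proj i , λ _ → proj-⇓

  const : ∀ n → Computable {k} (λ _ → n)
  const zero    = zeroᶠ , λ _ → zero-⇓
  const (suc n) =
    let p , p⇓ = const n
    in comp sucᶠ (p ∷ []) , λ xs → comp-⇓ (p⇓ xs ∷ []) suc-⇓

  apply₁ : ∀ {f F} → Recursive₁ f → Computable {k} F → Computable (λ xs → f (F xs))
  apply₁ (p , p⇓) (q , q⇓) =
    comp p (q ∷ []) , λ xs → comp-⇓ (q⇓ xs ∷ []) (p⇓ _)

  apply₂ : ∀ {f F G} → Recursive₂ f → Computable {k} F → Computable G →
           Computable (λ xs → f (F xs) (G xs))
  apply₂ (p , p⇓) (q , q⇓) (r , r⇓) =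
    comp p (q ∷ r ∷ []) , λ xs → comp-⇓ (q⇓ xs ∷ r⇓ xs ∷ []) (p⇓ _ _)

  apply₃ : ∀ {f F G H} → Recursive₃ f → Computable {k} F → Computable G → Computable H →
           Computable (λ xs → f (F xs) (G xs) (H xs))
  apply₃ (p , p⇓) (q , q⇓) (r , r⇓) (s , s⇓) =
    comp p (q ∷ r ∷ s ∷ []) ,
    λ xs → comp-⇓ (q⇓ xs ∷ r⇓ xs ∷ s⇓ xs ∷ []) (p⇓ _ _ _)

caseℕ-recursive : Recursive₃ caseℕ
-- The recursion step receives the counter, the previous value, `a` and `b`, so index 3 selects `b`.
caseℕ-recursive = prec (proj 0F) (proj 3F) , run
  where
  run : ∀ n a b → prec (proj 0F) (proj 3F) [ n ∷ a ∷ b ∷ [] ]⇓ caseℕ n a b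
  run zero    a b = prec-zero-⇓ proj-⇓
  run (suc n) a b = prec-suc-⇓ (run n a b) proj-⇓

pred-recursive : Recursive₁ pred
pred-recursive = prec zeroᶠ (proj 0F) , run
  where
  run : ∀ n → prec zeroᶠ (proj 0F) [ n ∷ [] ]⇓ pred n
  run zero    = prec-zero-⇓ zero-⇓
  run (suc n) = prec-suc-⇓ (run n) proj-⇓

fold-recursive : ∀ {f} → Recursive₁ f → Recursive₂ (λ n x → fold x f n)
fold-recursive {f} f-recursive = prec (proj 0F) (proj₁ step) , run
  where
  step : Computable {3} (λ xs → f (lookup xs 1F))
  step = apply₁ f-recursive (var 1F)

  run : ∀ n x → prec (proj 0F) (proj₁ step) [ n ∷ x ∷ [] ]⇓ fold x f n
  run zero    x = prec-zero-⇓ proj-⇓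
  run (suc n) x = prec-suc-⇓ (run n x) (proj₂ step _)

∸-recursive : Recursive₂ _∸_
-- `prec` recurses on its first argument, while subtraction iterates `pred` along the second; hence
-- the swap.
∸-recursive = proj₁ swapped , λ m n → ⇓-resp (fold-pred m n) (proj₂ swapped (m ∷ n ∷ []))
  where
  swapped : Computable {2} (λ xs → fold (lookup xs 0F) pred (lookup xs 1F))
  swapped = apply₂ (fold-recursive pred-recursive) (var 1F) (var 0F)

  fold-pred : ∀ m n → fold m pred n ≡ m ∸ n
  fold-pred m zero    = refl
  fold-pred m (suc n) = trans (cong pred (fold-pred m n)) (pred[m∸n]≡m∸[1+n] m n)

parity-recursive : Recursive₁ parity
parity-recursive = prec zeroᶠ (proj₁ step) , run
  where
  step : Computable {2} (λ xs → 1 ∸ lookup xs 1F)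
  step = apply₂ ∸-recursive (const 1) (var 1F)

  run : ∀ n → prec zeroᶠ (proj₁ step) [ n ∷ [] ]⇓ parity n
  run zero    = prec-zero-⇓ zero-⇓
  run (suc n) = prec-suc-⇓ (run n) (proj₂ step _)

-- Well-founded recursion is not among the schemes of `Rec`; minimisation over the number of
-- iterations replaces it, and `height-correct` guarantees that it halts.
height-recursive : ∀ {f} → Recursive₁ f → Recursive₁ (Height.height f)
height-recursive {f} f-recursive = μ (proj₁ test) , run
  where
  open Height f

  test : Computable {2} (λ xs → drop (fold (lookup xs 1F) f (lookup xs 0F)))
  test = apply₂ ∸-recursive iterate (apply₁ f-recursive iterate)
    where iterate = apply₂ (fold-recursive f-recursive) (var 0F) (var 1F)

  run : ∀ x → μ (proj₁ test) [ x ∷ [] ]⇓ height x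
  run x =
    let above , stop = height-correct x
    in μ-⇓ (λ i i<h → let z , eq = above i i<h in z , ⇓-resp eq (proj₂ test (i ∷ x ∷ [])))
           (⇓-resp stop (proj₂ test (height x ∷ x ∷ [])))

module _ {up down : ℕ → ℕ} (up-recursive : Recursive₁ up) (down-recursive : Recursive₁ down) where
  open PeakColoring up down

  private
    drop-up : Computable {1} (λ xs → lookup xs 0F ∸ up (lookup xs 0F))
    drop-up = apply₂ ∸-recursive (var 0F) (apply₁ up-recursive (var 0F))

    drop-down : Computable {1} (λ xs → lookup xs 0F ∸ down (lookup xs 0F))
    drop-down = apply₂ ∸-recursive (var 0F) (apply₁ down-recursive (var 0F))

  descend-recursive : Recursive₁ descend
  descend-recursive = recursive₁
    (apply₃ caseℕ-recursive drop-up
      (apply₃ caseℕ-recursive drop-down (var 0F) (apply₁ down-recursive (var 0F)))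
      (apply₁ up-recursive (var 0F)))

  color-recursive : Recursive₁ color
  color-recursive = recursive₁
    (apply₃ caseℕ-recursive drop-up level
      (apply₃ caseℕ-recursive drop-down level (const 2)))
    where
    level : Computable {1} (λ xs → parity (height (lookup xs 0F)))
    level = apply₁ parity-recursive (apply₁ (height-recursive descend-recursive) (var 0F))

-- Group translations as total functions on codes.

module Translation (G : ComputableGroup) where
  open ComputableGroup G

  private
    U? = proj₁ U-computable

  -- Numbers outside U are sent to 0#, because the program for _+_ need not
  -- halt on them.
  decode-dec : ∀ {x} → Dec (U x) → Carrier
  decode-dec {x} (yes x∈U) = x , x∈U
  decode-dec     (no  _)   = 0#

  decode : ℕ → Carrier
  decode x = decode-dec (U? x)

  decode-code : ∀ x → decode (proj₁ x) ≈ x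
  decode-code (x , x∈U) with U? x
  ... | yes _   = refl
  ... | no  x∉U = contradiction x∈U x∉U

  decode-recursive : Recursive₁ (λ x → proj₁ (decode x))
  decode-recursive =
    proj₁ program , λ x → ⇓-resp (select (U? x)) (proj₂ program (x ∷ []))
    where
    program : Computable {1} (λ xs → caseℕ (if does (U? (lookup xs 0F)) then 1 else 0)
                                           (proj₁ 0#) (lookup xs 0F))
    program = apply₃ caseℕ-recursive (apply₁ (proj₂ U-computable) (var 0F))
                     (const (proj₁ 0#)) (var 0F)

    -- Stated for an arbitrary decision, so that one match reduces both sides.
    select : ∀ {x} (x∈U? : Dec (U x)) →
             caseℕ (if does x∈U? then 1 else 0) (proj₁ 0#) x ≡ proj₁ (decode-dec x∈U?)
    select (yes _) = refl
    select (no  _) = refl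

  translate : Carrier → ℕ → ℕ
  translate a x = proj₁ (a + decode x)

  -- Decoding may change the membership proof of `x`; congruence of the group operation for `_≈_`
  -- absorbs the difference.
  translate-code : ∀ a x → translate a (proj₁ x) ≡ proj₁ (a + x)
  translate-code a x = IsGroup.∙-congˡ isGroup {a} (decode-code x)

  -- The code of the fixed element `a` is built into the program as a constant. The addition program
  -- only ever receives codes of group elements.
  translate-recursive : ∀ a → Recursive₁ (translate a)
  translate-recursive a =
    let p , p⇓ = add-computable
        q , q⇓ = const (proj₁ a)
        r , r⇓ = decode-recursive
    in comp p (q ∷ r ∷ []) ,
       λ x → comp-⇓ (q⇓ _ ∷ r⇓ x ∷ []) (p⇓ a (decode x))

proposition3p0p8 : (n : ℕ) → n > 2 →
    (G : ComputableGroup) → IsAbelian G →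
    (b : ComputableGroup.Carrier G) →
    ¬ (ComputableGroup._≈_ G b (ComputableGroup.0# G)) →
    Σ (Coloring G n) λ c →
    ComputableColoring G c × ¬ MonochromaticSolution G c b
proposition3p0p8 n n>2 G _ b b≉0 = coloring , computable , noSolution
  where
  open ComputableGroup G
  open Translation G
  open PeakColoring (translate b) (translate (- b))
  open IsGroup isGroup using (∙-congˡ; ∙-congʳ)
  open GroupProperties group using (//-rightDividesˡ; \\-leftDividesʳ; x≈y⇒x∙y⁻¹≈ε)

  color<n : ∀ x → color x < n
  -- `n > 2` unfolds to `3 ≤ n`.
  color<n x = <-≤-trans (color<3 x) n>2

  coloring : Coloring G n
  coloring = record
    { to   = λ x → fromℕ< (color<n (proj₁ x))
    ; cong = λ x≈y → fromℕ<-cong _ _ (cong color x≈y) _ _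
    }

  computable : ComputableColoring G coloring
  computable =
    let p , p⇓ = color-recursive (translate-recursive b) (translate-recursive (- b))
    in p , λ x → ⇓-resp (sym (toℕ-fromℕ< (color<n (proj₁ x)))) (p⇓ (proj₁ x))

  noSolution : ¬ MonochromaticSolution G coloring b
  -- A solution is an edge: `x` is the translate of `y` by `b`, and `y` that of `x` by `- b`.
  -- Passing through `toℕ` turns equal colours in `Fin n` into equal numbers.
  noSolution (x , y , x-y≈b , same) = color-≢
    (trans (translate-code b y) b+y≈x) (trans (translate-code (- b) x) -b+x≈y) x≢y
    (trans (sym (toℕ-fromℕ< _)) (trans (cong toℕ same) (toℕ-fromℕ< _)))
    where
    b+y≈x : (b + y) ≈ x
    b+y≈x = begin
      b + y       ≈⟨ ∙-congʳ {y} x-y≈b ⟨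
      (x - y) + y ≈⟨ //-rightDividesˡ y x ⟩
      x           ∎
      where open ≈-Reasoning ≈-setoid

    -b+x≈y : (- b + x) ≈ y
    -b+x≈y = begin
      - b + x       ≈⟨ ∙-congˡ { - b} b+y≈x ⟨
      - b + (b + y) ≈⟨ \\-leftDividesʳ b y ⟩
      y             ∎
      where open ≈-Reasoning ≈-setoid

    -- The endpoints differ because equal ones would have difference zero, forcing `b` to be zero.
    x≢y : proj₁ x ≢ proj₁ y
    x≢y x≈y = b≉0 (trans (sym x-y≈b) (x≈y⇒x∙y⁻¹≈ε {x} {y} x≈y))
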